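{- Let $T$ be a tree with at least one edge. Then $\mathrm{ch}'_{\mathrm{star}}(T) \leq \left\lfloor \frac{\theta(T) + \Delta(T)}{2} \right\rfloor$, where $\theta(T) = \max_{xy \in E(T)} \{ d_T(x) + d_T(y) \}$ and $\Delta(T)$ is the maximum degree of $T$.
   Context: A star $k$-edge coloring of a graph $G$ is a proper edge coloring $\phi: E(G) \to \{1,\dots,k\}$ such that no path or cycle of length four (i.e. with four edges) in $G$ is bichromatic. Given a list assignment $L$ assigning a finite set $L(e)$ to each edge $e$, $G$ is star $k$-edge choosable if for every $L$ with $|L(e)| \geq k$ for all $e$ there is a star edge coloring $\varphi$ with $\varphi(e) \in L(e)$ for all $e$. The list star chromatic index $\mathrm{ch}'_{\mathrm{star}}(G)$ is the minimum such $k$. -}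

module Defs where

open import Data.Nat using (ℕ; zero; suc; _+_; _≤_; _⊔_)
open import Data.Nat.DivMod using (_/_)
open import Data.Bool using (Bool; true; false; T)
open import Data.Fin using (Fin)
open import Data.List using (List; []; _∷_; length; filterᵇ; map; foldr; concatMap; allFin)
open import Data.List.Membership.Propositional using (_∈_)
open import Data.List.Relation.Unary.Unique.Propositional using (Unique)
open import Data.Product using (Σ; ∃; ∃-syntax; _×_; _,_)
open import Data.Sum using (_⊎_)
open import Relation.Binary.PropositionalEquality using (_≡_; _≢_)
open import Relation.Nullary using (¬_)

record Graph (n : ℕ) : Set where
  field
    adj   : Fin n → Fin n → Bool
    sym   : ∀ u v → adj u v ≡ adj v u
    irrefl : ∀ u → adj u u ≡ false

open Graph public

module _ {n : ℕ} (G : Graph n) where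

  Adj : Fin n → Fin n → Set
  Adj u v = T (adj G u v)

  data Walk : Fin n → Fin n → Set where
    here : ∀ {u} → Walk u u
    step : ∀ {u v w} → Adj u v → Walk v w → Walk u w

  Connected : Set
  Connected = ∀ u v → Walk u v

  data Chain : List (Fin n) → Set where
    nil  : Chain []
    one  : ∀ {u} → Chain (u ∷ [])
    cons : ∀ {u v vs} → Adj u v → Chain (v ∷ vs) → Chain (u ∷ v ∷ vs)

  data Cycle : Set where
    cycle : (x y z : Fin n) (vs : List (Fin n)) (last : Fin n) →
            Unique (x ∷ y ∷ z ∷ vs) → Chain (x ∷ y ∷ z ∷ vs) →
            last ∈ (z ∷ vs) → Adj last x →
            (∃[ pre ] (pre Data.List.++ (last ∷ [])) ≡ (z ∷ vs)) →
            Cycle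

  Acyclic : Set
  Acyclic = ¬ Cycle

  IsTree : Set
  IsTree = Connected × Acyclic

  HasEdge : Set
  HasEdge = ∃[ u ] ∃[ v ] Adj u v

  deg : Fin n → ℕ
  deg u = length (filterᵇ (adj G u) (allFin n))

  maxList : List ℕ → ℕ
  maxList = foldr _⊔_ 0

  Δ : ℕ
  Δ = maxList (map deg (allFin n))

  θ : ℕ
  θ = maxList (concatMap (λ u → map (λ v → deg u + deg v)
                                 (filterᵇ (adj G u) (allFin n))) (allFin n))

  -- list assignment: colours are natural numbers; L u v is the list of the
  -- (unordered) edge uv, so it must not depend on orientation
  ListAssignment : Set
  ListAssignment = Fin n → Fin n → List ℕ

  -- edge colouring, given on ordered pairs; only values on edges matter
  EdgeColouring : Set
  EdgeColouring = Fin n → Fin n → ℕ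

  WellDefinedL : ListAssignment → Set
  WellDefinedL L = ∀ u v → Adj u v → L u v ≡ L v u

  AdmissibleL : ℕ → ListAssignment → Set
  AdmissibleL k L = ∀ u v → Adj u v → Unique (L u v) × k ≤ length (L u v)

  WellDefinedC : EdgeColouring → Set
  WellDefinedC φ = ∀ u v → Adj u v → φ u v ≡ φ v u

  FromLists : ListAssignment → EdgeColouring → Set
  FromLists L φ = ∀ u v → Adj u v → φ u v ∈ L u v

  Proper : EdgeColouring → Set
  Proper φ = ∀ u v w → Adj u v → Adj u w → v ≢ w → φ u v ≢ φ u w

  PathOrCycle4 : Fin n → Fin n → Fin n → Fin n → Fin n → Set
  PathOrCycle4 v₀ v₁ v₂ v₃ v₄ =
    Adj v₀ v₁ × Adj v₁ v₂ × Adj v₂ v₃ × Adj v₃ v₄ ×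
    Unique (v₀ ∷ v₁ ∷ v₂ ∷ v₃ ∷ []) ×
    (Unique (v₀ ∷ v₁ ∷ v₂ ∷ v₃ ∷ v₄ ∷ []) ⊎ v₄ ≡ v₀)

  Bichromatic : EdgeColouring → Fin n → Fin n → Fin n → Fin n → Fin n → Set
  Bichromatic φ v₀ v₁ v₂ v₃ v₄ = ∃[ a ] ∃[ b ]
    ((φ v₀ v₁ ≡ a ⊎ φ v₀ v₁ ≡ b) × (φ v₁ v₂ ≡ a ⊎ φ v₁ v₂ ≡ b) ×
     (φ v₂ v₃ ≡ a ⊎ φ v₂ v₃ ≡ b) × (φ v₃ v₄ ≡ a ⊎ φ v₃ v₄ ≡ b))

  StarEdgeColouring : EdgeColouring → Set
  StarEdgeColouring φ = WellDefinedC φ × Proper φ ×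
    (∀ v₀ v₁ v₂ v₃ v₄ → PathOrCycle4 v₀ v₁ v₂ v₃ v₄ → ¬ Bichromatic φ v₀ v₁ v₂ v₃ v₄)

  StarEdgeChoosable : ℕ → Set
  StarEdgeChoosable k = ∀ (L : ListAssignment) → WellDefinedL L → AdmissibleL k L →
    ∃[ φ ] (FromLists L φ × StarEdgeColouring φ)

  -- ch'_star(G) ≤ m : the least k with G star k-edge choosable is ≤ m
  ListStarChromaticIndex≤ : ℕ → Set
  ListStarChromaticIndex≤ m = ∃[ k ] (k ≤ m × StarEdgeChoosable k)

-- Root the tree and colour the edges downwards, greedily from their lists.
-- Given properness, a bichromatic path v₀ v₁ v₂ v₃ v₄ means that the colour of
-- v₁v₂ recurs at v₃ and that of v₂v₃ recurs at v₁; so for each pair of edges at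
-- a vertex p it is enough to prevent one of the two recurrences.  Place the d
-- edges at p on a circle, the edge to the parent g of p first, and let each
-- edge dominate its ⌊d/2⌋ successors: of any two edges one dominates the other.
-- The edges below a child v of p avoid the colours of the edges dominated by pv.
-- Only the first ⌈d/2⌉ − 1 children of p fail to dominate the edge pg; their
-- edges to p instead avoid all colours at g.  Every edge then has fewer than
-- max (d(v) + ⌊d(p)/2⌋, d(p) + ⌊d(v)/2⌋) ≤ ⌊(θ + Δ)/2⌋ forbidden colours, where
-- v is its upper end and p the parent of v.
module Submission where

open import Defs hiding (sym)
open import Data.Bool using (T)
open import Data.Bool.Properties using (T?)
open import Data.Empty using (⊥; ⊥-elim)
open import Data.Fin using (Fin; _≟_)
open import Data.List using
  (List; []; _∷_; _++_; length; map; filter; filterᵇ; applyUpTo; allFin)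
open import Data.List.Properties using
  (length-map; length-++; length-filter; filter-notAll; length-applyUpTo;
   map-cong-local; length-tabulate)
open import Data.List.Membership.Propositional using (_∈_; _∉_)
open import Data.List.Membership.Propositional.Properties
  using (∈-∃++; ∈-++⁺ˡ; ∈-++⁺ʳ; ∈-++⁻; ∈-filter⁺; ∈-filter⁻; ∈-map⁺; ∈-applyUpTo⁺;
         ∈-applyUpTo⁻; ∈-allFin; ∈-concatMap⁺)
open import Data.List.Relation.Unary.Any using (here; there)
import Data.List.Relation.Unary.Any as Any
open import Data.List.Relation.Unary.All using (All; []; _∷_)
import Data.List.Relation.Unary.All as All
import Data.List.Relation.Unary.All.Properties as All
open import Data.List.Relation.Unary.AllPairs using ([]; _∷_)
open import Data.List.Relation.Unary.Unique.Propositional using (Unique)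
open import Data.List.Relation.Unary.Unique.Propositional.Properties using (Unique[x∷xs]⇒x∉xs)
open import Data.Nat using (ℕ; zero; suc; _+_; _*_; _≤_; _<_; z≤n; s≤s; _<?_)
import Data.Nat as ℕ
open import Data.Nat.DivMod using
  (_/_; _%_; m≡m%n+[m/n]*n; m%n<n; /-monoˡ-≤; +-distrib-/-∣ˡ; m*n/n≡m)
open import Data.Nat.Divisibility using (divides-refl)
open import Data.Nat.Properties hiding (_≟_; _<?_)
open import Data.Product using (Σ; ∃-syntax; _×_; _,_; proj₁; proj₂)
open import Data.Sum using (_⊎_; inj₁; inj₂; reduce)
open import Function using (_∘_)
open import Relation.Binary.PropositionalEquality
  using (_≡_; _≢_; refl; sym; trans; cong; subst; ≢-sym)
open import Relation.Binary.Definitions using (tri<; tri≈; tri>)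
open import Relation.Nullary using (Dec; yes; no; ¬_; contradiction)
open import Relation.Nullary.Decidable using (¬?)

-- List entries by position, with a default

module _ {A : Set} where

  -- The default `d` makes lookup total. Choosing it inside the intended list keeps lookups past the
  -- end harmless, as in `nth-⊆`.
  nth : A → List A → ℕ → A
  nth d []       _       = d
  nth d (x ∷ xs) zero    = x
  nth d (x ∷ xs) (suc i) = nth d xs i

  nth-∈ : ∀ d xs {i} → i < length xs → nth d xs i ∈ xs
  nth-∈ d (x ∷ xs) {zero}  _       = here refl
  nth-∈ d (x ∷ xs) {suc i} (s≤s p) = there (nth-∈ d xs p)

  nth-⊆ : ∀ {d zs} xs i → d ∈ zs → (∀ {x} → x ∈ xs → x ∈ zs) → nth d xs i ∈ zs
  nth-⊆ []       i       d∈ xs⊆ = d∈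
  nth-⊆ (x ∷ xs) zero    d∈ xs⊆ = xs⊆ (here refl)
  nth-⊆ (x ∷ xs) (suc i) d∈ xs⊆ = nth-⊆ xs i d∈ (xs⊆ ∘ there)

  nth-++ˡ : ∀ d xs ys {i} → i < length xs → nth d (xs ++ ys) i ≡ nth d xs i
  nth-++ˡ d (x ∷ xs) ys {zero}  _       = refl
  nth-++ˡ d (x ∷ xs) ys {suc i} (s≤s p) = nth-++ˡ d xs ys p

  nth-++ʳ : ∀ d xs ys i → nth d (xs ++ ys) (length xs + i) ≡ nth d ys i
  nth-++ʳ d []       ys i = refl
  nth-++ʳ d (x ∷ xs) ys i = nth-++ʳ d xs ys i

m≤1+2⌊m/2⌋ : ∀ m → m ≤ suc (m / 2 + m / 2)
m≤1+2⌊m/2⌋ m = begin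
  m                     ≡⟨ m≡m%n+[m/n]*n m 2 ⟩
  m % 2 + m / 2 * 2     ≤⟨ +-monoˡ-≤ (m / 2 * 2) (ℕ.s≤s⁻¹ (m%n<n m 2)) ⟩
  suc (m / 2 * 2)       ≡⟨ cong suc (trans (*-comm (m / 2) 2) (cong (m / 2 +_) (+-identityʳ _))) ⟩
  suc (m / 2 + m / 2)   ∎
  where open ≤-Reasoning

-- Positions of vertices and cyclic dominance

module _ {n : ℕ} where

  idx : Fin n → List (Fin n) → ℕ
  idx w [] = 0
  idx w (x ∷ xs) with w ≟ x
  ... | yes _ = 0
  ... | no  _ = suc (idx w xs)

  idx-< : ∀ {w xs} → w ∈ xs → idx w xs < length xs
  idx-< {w} {x ∷ xs} p with w ≟ x
  ... | yes _ = s≤s z≤n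
  idx-< {w} {x ∷ xs} (here e)  | no ne = contradiction e ne
  idx-< {w} {x ∷ xs} (there p) | no ne = s≤s (idx-< p)

  idx-≤ : ∀ w xs → idx w xs ≤ length xs
  idx-≤ w [] = z≤n
  idx-≤ w (x ∷ xs) with w ≟ x
  ... | yes _ = z≤n
  ... | no  _ = s≤s (idx-≤ w xs)

  nth-idx : ∀ d {w xs} → w ∈ xs → nth d xs (idx w xs) ≡ w
  nth-idx d {w} {x ∷ xs} p with w ≟ x
  ... | yes e = sym e
  nth-idx d {w} {x ∷ xs} (here e)  | no ne = contradiction e ne
  nth-idx d {w} {x ∷ xs} (there p) | no ne = nth-idx d p

  -- Only an inequality: `xs` may repeat entries, and `idx` finds the first occurrence.
  idx-nth : ∀ d xs {i} → i < length xs → idx (nth d xs i) xs ≤ i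
  idx-nth d (x ∷ xs) {zero}  _ with x ≟ x
  ... | yes _ = z≤n
  ... | no ne = contradiction refl ne
  idx-nth d (x ∷ xs) {suc i} (s≤s p) with nth d xs i ≟ x
  ... | yes _ = z≤n
  ... | no _  = s≤s (idx-nth d xs p)

  idx-head : ∀ w xs → idx w (w ∷ xs) ≡ 0
  idx-head w xs with w ≟ w
  ... | yes _ = refl
  ... | no ne = contradiction refl ne

  idx-tail : ∀ {w x} xs → w ≢ x → idx w (x ∷ xs) ≡ suc (idx w xs)
  idx-tail {w} {x} xs ne with w ≟ x
  ... | yes e = contradiction e ne
  ... | no _  = refl

  idx-inj : ∀ {w x xs} → w ∈ xs → x ∈ xs → idx w xs ≡ idx x xs → w ≡ x
  idx-inj {w} {x} {xs} p q e =
    trans (sym (nth-idx w p)) (trans (cong (nth w xs) e) (nth-idx w q))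

  -- Cyclic successors: arranging xs on a circle, each element dominates the
  -- ⌊ length xs / 2 ⌋ next ones.
  after : Fin n → List (Fin n) → List (Fin n)
  after v xs = applyUpTo (λ t → nth v (xs ++ xs) (suc (idx v xs) + t)) (length xs / 2)

  length-after : ∀ v xs → length (after v xs) ≡ length xs / 2
  length-after v xs = length-applyUpTo (λ t → nth v (xs ++ xs) (suc (idx v xs) + t)) (length xs / 2)

  ∈-after : ∀ v xs {i} → suc (idx v xs) ≤ i → i < suc (idx v xs) + length xs / 2 →
            nth v (xs ++ xs) i ∈ after v xs
  ∈-after v xs {i} lo hi with m≤n⇒∃[o]m+o≡n lo
  ... | t , refl = ∈-applyUpTo⁺ _ (+-cancelˡ-< (suc (idx v xs)) _ _ hi)

  after-⊆ : ∀ {v xs y} → v ∈ xs → y ∈ after v xs → y ∈ xs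
  after-⊆ {v} {xs} v∈ y∈ with ∈-applyUpTo⁻ _ y∈
  ... | t , _ , refl = nth-⊆ (xs ++ xs) (suc (idx v xs) + t) v∈ (reduce ∘ ∈-++⁻ xs)

  -- The doubled list `xs ++ xs` unrolls the circle; position `length xs + idx x xs` is the second
  -- copy of `x`, met after passing the end.
  after-wrap : ∀ {v x xs} → x ∈ xs →
               idx v xs < length xs + idx x xs →
               length xs + idx x xs ≤ idx v xs + length xs / 2 → x ∈ after v xs
  after-wrap {v} {x} {xs} x∈ lo hi =
    subst (_∈ after v xs)
      (trans (nth-++ʳ v xs xs (idx x xs)) (nth-idx v x∈))
      (∈-after v xs lo (s≤s hi))

  -- The two distances between `x` and `y` around the circle add up to `d ≤ 2h + 1`, so one of them
  -- is at most `h`.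
  after-total-< : ∀ {x y xs} → x ∈ xs → y ∈ xs → idx x xs < idx y xs →
                  y ∈ after x xs ⊎ x ∈ after y xs
  after-total-< {x} {y} {xs} x∈ y∈ lt with idx y xs <? suc (idx x xs) + length xs / 2
  ... | yes hi = inj₁ (subst (_∈ after x xs)
          (trans (nth-++ˡ x xs xs (idx-< y∈)) (nth-idx x y∈))
          (∈-after x xs lt hi))
  ... | no ¬hi = inj₂ (after-wrap x∈ (≤-trans (idx-< y∈) (m≤m+n _ _)) (begin
      d + idx x xs                  ≤⟨ +-monoˡ-≤ _ (m≤1+2⌊m/2⌋ d) ⟩
      suc (h + h) + idx x xs        ≡⟨ cong suc (+-comm (h + h) _) ⟩
      suc (idx x xs + (h + h))      ≡⟨ cong suc (sym (+-assoc (idx x xs) h h)) ⟩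
      suc (idx x xs) + h + h        ≤⟨ +-monoˡ-≤ h (≮⇒≥ ¬hi) ⟩
      idx y xs + h                  ∎))
    where
    open ≤-Reasoning
    d = length xs
    h = length xs / 2

  after-total : ∀ {x y xs} → x ∈ xs → y ∈ xs → x ≢ y →
                y ∈ after x xs ⊎ x ∈ after y xs
  after-total {x} {y} {xs} x∈ y∈ ne with <-cmp (idx x xs) (idx y xs)
  ... | tri< lt _ _ = after-total-< x∈ y∈ lt
  ... | tri≈ _ e _ = contradiction (idx-inj x∈ y∈ e) ne
  ... | tri> _ _ gt with after-total-< y∈ x∈ gt
  ...   | inj₁ p = inj₂ p
  ...   | inj₂ p = inj₁ p

  before : Fin n → List (Fin n) → List (Fin n)
  before v xs = applyUpTo (nth v xs) (idx v xs)

  length-before : ∀ v xs → length (before v xs) ≡ idx v xs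
  length-before v xs = length-applyUpTo (nth v xs) (idx v xs)

  ∈-before : ∀ {v x xs} → x ∈ xs → idx x xs < idx v xs → x ∈ before v xs
  ∈-before {v} {x} {xs} x∈ lt = subst (_∈ before v xs) (nth-idx v x∈) (∈-applyUpTo⁺ (nth v xs) lt)

  before-⊆ : ∀ {v x xs} → v ∈ xs → x ∈ before v xs → x ∈ xs × idx x xs < idx v xs
  before-⊆ {v} {x} {xs} v∈ x∈ with ∈-applyUpTo⁻ (nth v xs) x∈
  ... | t , t< , refl = nth-∈ v xs t<len , ≤-<-trans (idx-nth v xs t<len) t<
    where t<len = <-trans t< (idx-< v∈)

-- Greedy list colouring

pick : List ℕ → List ℕ → ℕ
pick []       F = 0
pick (x ∷ xs) F with Any.any? (x ℕ.≟_) F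
... | yes _ = pick xs (filter (¬? ∘ (x ℕ.≟_)) F)
... | no  _ = x

-- Each rejected colour also deletes at least one entry of `F`, so the strict inequality of lengths
-- survives.
pick-spec : ∀ xs F → Unique xs → length F < length xs → pick xs F ∈ xs × pick xs F ∉ F
pick-spec (x ∷ xs) F u@(_ ∷ uxs) lt with Any.any? (x ℕ.≟_) F
... | no x∉F = here refl , x∉F
... | yes x∈F =
  let c∈ , c∉ = pick-spec xs (filter (¬? ∘ (x ℕ.≟_)) F) uxs
                  (<-≤-trans (filter-notAll _ F (Any.map (λ e ne → ne e) x∈F)) (ℕ.s≤s⁻¹ lt))
  -- The chosen colour lies in the duplicate-free tail, hence differs from `x`; deleting `x` from
  -- `F` hid no conflict.
  in there c∈ , λ c∈F → c∉ (∈-filter⁺ _ c∈F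
       λ x≡c → Unique[x∷xs]⇒x∉xs u (subst (_∈ xs) (sym x≡c) c∈))

module _ {A : Set} (rank : A → ℕ) (forb : A → List A)
         (forb-rank : ∀ w {u} → u ∈ forb w → rank u < rank w) (L : A → List ℕ) where

  private
    C : ℕ → A → ℕ
    C zero    w = 0
    C (suc f) w = pick (L w) (map (C f) (forb w))

    -- The first argument of `C` is fuel. Forbidden elements have smaller rank, so fuel above the
    -- rank never runs out.
    C-stable : ∀ f g w → rank w < f → rank w < g → C f w ≡ C g w
    C-stable (suc f) (suc g) w (s≤s p) (s≤s q) = cong (pick (L w))
      (map-cong-local (All.tabulate λ {u} u∈ → C-stable f g u
         (<-≤-trans (forb-rank w u∈) p) (<-≤-trans (forb-rank w u∈) q)))

  -- The list conditions are imposed separately at each `w`, so an element that stands for no edge,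
  -- such as the root, needs no valid list.
  greedy : ∃[ c ] (∀ w → Unique (L w) → length (forb w) < length (L w) →
                   c w ∈ L w × (∀ {u} → u ∈ forb w → c w ≢ c u))
  greedy = (λ w → C (suc (rank w)) w) , λ w uq lt →
    let c∈ , c∉ = pick-spec (L w) (map (C (rank w)) (forb w)) uq
                    (subst (_< length (L w)) (sym (length-map _ (forb w))) lt)
    in c∈ , λ {u} u∈ e → c∉ (subst (_∈ map (C (rank w)) (forb w))
         (trans (C-stable (rank w) (suc (rank u)) u (forb-rank w u∈) ≤-refl) (sym e))
         (∈-map⁺ _ u∈))

-- Rooting a tree

module _ {n : ℕ} (G : Graph n) where

  Adj-sym : ∀ {u v} → Adj G u v → Adj G v u
  Adj-sym {u} {v} = subst T (Graph.sym G u v)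

  Adj⇒≢ : ∀ {u v} → Adj G u v → u ≢ v
  Adj⇒≢ {u} a refl = subst T (Graph.irrefl G u) a

  -- A local condition, comparing only vertices two apart, so it is easy to extend and reverse;
  -- `NB⇒Unique` shows that in an acyclic graph it already gives paths.
  data NonBacktracking : List (Fin n) → Set where
    [-]   : ∀ {x} → NonBacktracking (x ∷ [])
    [-,-] : ∀ {x y} → Adj G x y → NonBacktracking (x ∷ y ∷ [])
    turn  : ∀ {x y z zs} → Adj G x y → x ≢ z →
            NonBacktracking (y ∷ z ∷ zs) → NonBacktracking (x ∷ y ∷ z ∷ zs)

  data EndsAt (r : Fin n) : List (Fin n) → Set where
    end  : EndsAt r (r ∷ [])
    more : ∀ {x y ys} → EndsAt r (y ∷ ys) → EndsAt r (x ∷ y ∷ ys)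

  EndsAt⇒∈ : ∀ {r xs} → EndsAt r xs → r ∈ xs
  EndsAt⇒∈ end      = here refl
  EndsAt⇒∈ (more e) = there (EndsAt⇒∈ e)

  NB⇒Chain : ∀ {xs} → NonBacktracking xs → Chain G xs
  NB⇒Chain [-]          = one
  NB⇒Chain ([-,-] a)    = cons a one
  NB⇒Chain (turn a _ c) = cons a (NB⇒Chain c)

  NB-tail : ∀ {x y ys} → NonBacktracking (x ∷ y ∷ ys) → NonBacktracking (y ∷ ys)
  NB-tail ([-,-] _)    = [-]
  NB-tail (turn _ _ c) = c

  NB-head : ∀ {x y ys} → NonBacktracking (x ∷ y ∷ ys) → Adj G x y
  NB-head ([-,-] a)    = a
  NB-head (turn a _ _) = a

  Unique-prefix : ∀ (ps : List (Fin n)) {x ws} → Unique (ps ++ x ∷ ws) → Unique (x ∷ ps)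
  Unique-prefix []       _ = [] ∷ []
  Unique-prefix (p ∷ ps) (p∉ ∷ u) with All.++⁻ ps p∉ | Unique-prefix ps u
  ... | p∉ps , p≢x ∷ _ | x∉ps ∷ ups = (≢-sym p≢x ∷ x∉ps) ∷ (p∉ps ∷ ups)

  -- Cuts a walk just before `x` and names the last vertex `l`, in the form that `cycle` expects.
  Chain-prefix : ∀ p ps {x ws} → Chain G (p ∷ ps ++ x ∷ ws) →
    Chain G (p ∷ ps) × ∃[ l ] (l ∈ p ∷ ps × Adj G l x × ∃[ pre ] pre ++ l ∷ [] ≡ p ∷ ps)
  Chain-prefix p []       (cons a _) = one , p , here refl , a , [] , refl
  Chain-prefix p (q ∷ ps) (cons a c) with Chain-prefix q ps c
  ... | c′ , l , l∈ , al , pre , e = cons a c′ , l , there l∈ , al , p ∷ pre , cong (p ∷_) e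

  module _ (acyclic : Acyclic G) where

    -- By induction the tail has no repetition, so a return to the head `x` closes a cycle. It has
    -- at least three vertices because `x ≢ y` and `x ≢ z`.
    NB⇒Unique : ∀ {xs} → NonBacktracking xs → Unique xs
    NB⇒Unique [-]       = [] ∷ []
    NB⇒Unique ([-,-] a) = (Adj⇒≢ a ∷ []) ∷ [] ∷ []
    NB⇒Unique (turn {x} {y} {z} {zs} a x≢z c) =
      (Adj⇒≢ a ∷ x≢z ∷ All.tabulate λ { x∈ refl → x∉ x∈ }) ∷ NB⇒Unique c
      where
      x∉ : x ∉ zs
      x∉ x∈ with ∈-∃++ x∈
      ... | ys , ws , refl with NB⇒Chain c
      ...   | cons b ch with Chain-prefix z ys ch
      ...     | ch′ , l , l∈ , al , pre =
        acyclic (cycle x y z ys l (Unique-prefix (y ∷ z ∷ ys) (NB⇒Unique c))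
                   (cons a (cons b ch′)) l∈ al pre)

    -- Two paths out of a to r starting differently would form, one reversed
    -- and followed by the other, a non-backtracking walk visiting r twice.
    no-fork : ∀ {r a x} xs {ys} → NonBacktracking (a ∷ x ∷ xs) → NonBacktracking (x ∷ a ∷ ys) →
              EndsAt r (x ∷ xs) → r ∈ ys → ⊥
    no-fork []        _            d end      r∈ = Unique[x∷xs]⇒x∉xs (NB⇒Unique d) (there r∈)
    no-fork (x′ ∷ xs) (turn _ a≢x′ c) d (more e) r∈ =
      no-fork xs c (turn (Adj-sym (NB-head c)) (≢-sym a≢x′) d) e (there r∈)

    path-unique : ∀ {r v} xs ys → NonBacktracking (v ∷ xs) → EndsAt r (v ∷ xs) →
                  NonBacktracking (v ∷ ys) → EndsAt r (v ∷ ys) → xs ≡ ys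
    path-unique []       []       _ _   _ _        = refl
    path-unique []       (y ∷ ys) _ end d (more e) =
      contradiction (EndsAt⇒∈ e) (Unique[x∷xs]⇒x∉xs (NB⇒Unique d))
    path-unique (x ∷ xs) []       c (more e) _ end =
      contradiction (EndsAt⇒∈ e) (Unique[x∷xs]⇒x∉xs (NB⇒Unique c))
    path-unique (x ∷ xs) (y ∷ ys) c (more e) d (more f) with x ≟ y
    ... | yes refl = cong (x ∷_) (path-unique xs ys (NB-tail c) e (NB-tail d) f)
    ... | no x≢y   = ⊥-elim (no-fork xs c (turn (Adj-sym (NB-head c)) x≢y d) e (EndsAt⇒∈ f))

    Path : Fin n → Fin n → Set
    Path r v = ∃[ xs ] (NonBacktracking (v ∷ xs) × EndsAt r (v ∷ xs))

    -- The path is lengthened by `u`, or shortened if it already leaves `v` through `u`. The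
    -- recorded alternative later orients the edge.
    extend : ∀ {r u v} → Adj G u v → (p : Path r v) →
             Σ (Path r u) λ q → proj₁ q ≡ v ∷ proj₁ p ⊎ proj₁ p ≡ u ∷ proj₁ q
    extend a ([] , c , e) = (_ , [-,-] a , more e) , inj₁ refl
    extend {u = u} a (x ∷ xs , c , more e) with u ≟ x
    ... | yes refl = (xs , NB-tail c , e) , inj₂ refl
    ... | no u≢x   = (_ , turn a u≢x c , more (more e)) , inj₁ refl

    Walk⇒Path : ∀ {r v} → Walk G v r → Path r v
    Walk⇒Path here       = [] , [-] , end
    Walk⇒Path (step a w) = proj₁ (extend a (Walk⇒Path w))

  record Rooting : Set where
    field
      depth  : Fin n → ℕ
      parent : Fin n → Fin n

    -- The depth equation excludes the root, whose `parent` is an arbitrary value.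
    Child : Fin n → Fin n → Set
    Child u v = parent u ≡ v × depth u ≡ suc (depth v)

    field
      parent-adj   : ∀ {v d} → depth v ≡ suc d → Adj G v (parent v)
      parent-depth : ∀ {v d} → depth v ≡ suc d → depth (parent v) ≡ d
      orient       : ∀ {u v} → Adj G u v → Child u v ⊎ Child v u

  -- Depth is the length of the path to `r`, and the parent is its second vertex, by default `r`
  -- itself at `r`. Uniqueness of paths makes the paths chosen at adjacent vertices agree.
  rooting : IsTree G → Fin n → Rooting
  rooting (connected , acyclic) r = record
    { depth        = length ∘ tail
    ; parent       = λ v → nth v (tail v) 0
    ; parent-adj   = λ {v} → parent-adj v
    ; parent-depth = λ {v} → parent-depth v
    ; orient       = orient
    }
    where
    path : ∀ v → Path acyclic r v
    path v = Walk⇒Path acyclic (connected v r)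
    tail : Fin n → List (Fin n)
    tail v = proj₁ (path v)
    parent-adj : ∀ v {d} → length (tail v) ≡ suc d → Adj G v (nth v (tail v) 0)
    parent-adj v _ with path v
    ... | x ∷ xs , c , _ = NB-head c
    parent-depth : ∀ v {d} → length (tail v) ≡ suc d → length (tail (nth v (tail v) 0)) ≡ d
    parent-depth v eq with path v
    ... | x ∷ xs , c , more e with path x
    ...   | ys , c′ , e′ = trans (cong length (path-unique acyclic ys xs c′ e′ (NB-tail c) e)) (suc-injective eq)
    child : ∀ {u v} → tail u ≡ v ∷ tail v → nth u (tail u) 0 ≡ v × length (tail u) ≡ suc (length (tail v))
    child {u} e = cong (λ xs → nth u xs 0) e , cong length e
    orient : ∀ {u v} → Adj G u v → _ ⊎ _
    orient {u} {v} a with extend acyclic a (path v)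
    ... | (xs , c , e) , which
      with refl ← path-unique acyclic (tail u) xs (proj₁ (proj₂ (path u))) (proj₂ (proj₂ (path u))) c e
      with which
    ...   | inj₁ eq = inj₁ (child eq)
    ...   | inj₂ eq = inj₂ (child eq)

-- The bound ⌊(θ + Δ) / 2⌋

module _ {n : ℕ} (G : Graph n) where

  nbrs : Fin n → List (Fin n)
  nbrs v = filterᵇ (adj G v) (allFin n)

  ∈-nbrs : ∀ {u v} → Adj G v u → u ∈ nbrs v
  ∈-nbrs {u} {v} a = ∈-filter⁺ (T? ∘ adj G v) (∈-allFin u) a

  ≤-maxList : ∀ {x xs} → x ∈ xs → x ≤ maxList G xs
  ≤-maxList {xs = y ∷ ys} (here refl) = m≤m⊔n y (maxList G ys)
  ≤-maxList {xs = y ∷ ys} (there x∈)  = ≤-trans (≤-maxList x∈) (m≤n⊔m y (maxList G ys))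

  deg≤Δ : ∀ v → deg G v ≤ Δ G
  deg≤Δ v = ≤-maxList (∈-map⁺ (deg G) (∈-allFin v))

  deg+deg≤θ : ∀ {u v} → Adj G u v → deg G u + deg G v ≤ θ G
  deg+deg≤θ {u} {v} a = ≤-maxList (∈-concatMap⁺ _
    (Any.map (λ { refl → ∈-map⁺ _ (∈-nbrs a) }) (∈-allFin u)))

  bound : ℕ
  bound = (θ G + Δ G) / 2

  -- With `a₁` and `b₁` the two degrees, the left side is half of `2a₁ + b₁ = (a₁ + b₁) + a₁`,
  -- rounded down; the bracket is at most `θ G` and the last term at most `Δ G`.
  deg+half≤bound : ∀ {u v} → Adj G u v → deg G u + deg G v / 2 ≤ bound
  deg+half≤bound {u} {v} a = begin
    a₁ + b₁ / 2             ≡⟨ cong (_+ b₁ / 2) (sym (m*n/n≡m a₁ 2)) ⟩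
    a₁ * 2 / 2 + b₁ / 2     ≡⟨ sym (+-distrib-/-∣ˡ b₁ (divides-refl a₁)) ⟩
    (a₁ * 2 + b₁) / 2       ≤⟨ /-monoˡ-≤ 2 (begin
      a₁ * 2 + b₁           ≡⟨ cong (_+ b₁) (trans (*-comm a₁ 2) (cong (a₁ +_) (+-identityʳ a₁))) ⟩
      a₁ + a₁ + b₁          ≡⟨ +-assoc a₁ a₁ b₁ ⟩
      a₁ + (a₁ + b₁)        ≡⟨ +-comm a₁ (a₁ + b₁) ⟩
      (a₁ + b₁) + a₁        ≤⟨ +-mono-≤ (deg+deg≤θ a) (deg≤Δ u) ⟩
      θ G + Δ G             ∎) ⟩
    bound                   ∎
    where
    open ≤-Reasoning
    a₁ = deg G u
    b₁ = deg G v

-- An edge is represented by its lower endpoint, so for a non-root v the head v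
-- of edgesAt v is the edge above v.

module _ {n : ℕ} (G : Graph n) (R : Rooting G) where

  open Rooting R

  Child⇒Adj : ∀ {u v} → Child u v → Adj G u v
  Child⇒Adj {u} (refl , e) = parent-adj e

  Child⇒≢ : ∀ {u v} → Child u v → u ≢ v
  Child⇒≢ c = Adj⇒≢ G (Child⇒Adj c)

  deeper : ∀ v u → Dec (depth v < depth u)
  deeper v u = depth v <? depth u

  -- Abstract, so that case distinctions on depth v do not reach inside.
  abstract
    children : Fin n → List (Fin n)
    children v = filter (deeper v) (nbrs G v)

    ∈-children⁺ : ∀ {u v} → Child u v → u ∈ children v
    ∈-children⁺ {u} {v} c@(_ , e) =
      ∈-filter⁺ (deeper v) (∈-nbrs G (Adj-sym G (Child⇒Adj c))) (≤-reflexive (sym e))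

    ∈-children⁻ : ∀ {u v} → u ∈ children v → Child u v
    ∈-children⁻ {u} {v} u∈ with ∈-filter⁻ (deeper v) {xs = nbrs G v} u∈
    ... | u∈nbrs , lt with orient (proj₂ (∈-filter⁻ (T? ∘ adj G v) {xs = allFin n} u∈nbrs))
    ...   | inj₁ (_ , e) = contradiction lt (≤⇒≯ (≤-trans (n≤1+n _) (≤-reflexive (sym e))))
    ...   | inj₂ c       = c

    length-children : ∀ v → length (children v) ≤ deg G v
    length-children v = length-filter _ (nbrs G v)

    length-children-< : ∀ {v d} → depth v ≡ suc d → length (children v) < deg G v
    length-children-< {v} {d} eq =
      filter-notAll _ (nbrs G v) (Any.map notDeeper (∈-nbrs G (parent-adj eq)))
      where
      notDeeper : ∀ {u} → parent v ≡ u → ¬ depth v < depth u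
      notDeeper refl lt = <⇒≱ lt (≤-trans (≤-reflexive (parent-depth eq)) (≤-trans (n≤1+n d) (≤-reflexive (sym eq))))

  edgesAt′ : ℕ → Fin n → List (Fin n)
  edgesAt′ zero    v = children v
  edgesAt′ (suc _) v = v ∷ children v

  edgesAt : Fin n → List (Fin n)
  edgesAt v = edgesAt′ (depth v) v

  length-edgesAt : ∀ v → length (edgesAt v) ≤ deg G v
  length-edgesAt v with depth v in eq
  ... | zero  = length-children v
  ... | suc d = length-children-< eq

  children⊆edgesAt : ∀ {u v} → u ∈ children v → u ∈ edgesAt v
  children⊆edgesAt {v = v} u∈ with depth v
  ... | zero  = u∈
  ... | suc _ = there u∈

  self∈edgesAt : ∀ {v d} → depth v ≡ suc d → v ∈ edgesAt v
  self∈edgesAt {v} e rewrite e = here refl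

  edgesAt⁻ : ∀ {u v} → u ∈ edgesAt v → u ≡ v ⊎ Child u v
  edgesAt⁻ {v = v} = go (depth v)
    where
    go : ∀ d {u} → u ∈ edgesAt′ d v → u ≡ v ⊎ Child u v
    go zero    u∈         = inj₂ (∈-children⁻ u∈)
    go (suc d) (here e)   = inj₁ e
    go (suc d) (there u∈) = inj₂ (∈-children⁻ u∈)

  edgesAt-depth : ∀ {u v} → u ∈ edgesAt v → depth u ≤ suc (depth v)
  edgesAt-depth u∈ with edgesAt⁻ u∈
  ... | inj₁ refl    = n≤1+n _
  ... | inj₂ (_ , e) = ≤-reflexive e

  lower : Fin n → Fin n → Fin n
  lower u v with deeper u v
  ... | yes _ = v
  ... | no  _ = u

  lower-child : ∀ {u v} → Child u v → lower v u ≡ u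
  lower-child {u} {v} (_ , e) with deeper v u
  ... | yes _ = refl
  ... | no ¬p = contradiction (≤-reflexive (sym e)) ¬p

  lower-child′ : ∀ {u v} → Child u v → lower u v ≡ u
  lower-child′ {u} {v} (_ , e) with deeper u v
  ... | yes p = contradiction p (≤⇒≯ (≤-trans (n≤1+n _) (≤-reflexive (sym e))))
  ... | no _  = refl

  lower-sym : ∀ {u v} → Adj G u v → lower u v ≡ lower v u
  lower-sym a with orient a
  ... | inj₁ c = trans (lower-child′ c) (sym (lower-child c))
  ... | inj₂ c = trans (lower-child c) (sym (lower-child′ c))

  lower∈edgesAt : ∀ {u v} → Adj G v u → lower v u ∈ edgesAt v
  lower∈edgesAt {u} {v} a with orient a
  ... | inj₁ c@(_ , e) = subst (_∈ edgesAt v) (sym (lower-child′ c)) (self∈edgesAt e)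
  ... | inj₂ c = subst (_∈ edgesAt v) (sym (lower-child c)) (children⊆edgesAt (∈-children⁺ c))

  -- Forbidden edges

  siblingIdx : Fin n → ℕ
  siblingIdx w = idx w (children (parent w))

  -- The cyclic successors of w in edgesAt (parent w) do not reach back to the
  -- edge above parent w, which has index 0.
  Early : Fin n → Set
  Early w = suc (siblingIdx w) + length (edgesAt (parent w)) / 2 < length (edgesAt (parent w))

  early? : ∀ w → Dec (Early w)
  early? w = suc (siblingIdx w) + length (edgesAt (parent w)) / 2 <? length (edgesAt (parent w))

  -- An early edge must share no colour with the grandparent: the edge above
  -- parent w is not among its successors, so this conflict has to be settled
  -- on the grandparent's side.
  inherited : Fin n → List (Fin n)
  inherited w with early? w
  ... | yes _ = edgesAt (parent (parent w))
  ... | no  _ = parent w ∷ after (parent w) (edgesAt (parent (parent w)))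

  -- The root stands for no edge, and an edge at the root has no grandparent to inherit from.
  -- Earlier siblings are listed for properness.
  forb′ : ℕ → Fin n → List (Fin n)
  forb′ zero          w = []
  forb′ (suc zero)    w = before w (children (parent w))
  forb′ (suc (suc _)) w = before w (children (parent w)) ++ inherited w

  forb : Fin n → List (Fin n)
  forb w = forb′ (depth w) w

  Child-parent : ∀ {v d} → depth v ≡ suc d → Child v (parent v)
  Child-parent e = refl , trans e (cong suc (sym (parent-depth e)))

  v∈edgesAt-parent : ∀ {v d} → depth v ≡ suc d → v ∈ edgesAt (parent v)
  v∈edgesAt-parent e = children⊆edgesAt (∈-children⁺ (Child-parent e))

  before⊆forb : ∀ {w d x} → depth w ≡ suc d → x ∈ before w (children (parent w)) → x ∈ forb w
  before⊆forb {d = zero}  e x∈ rewrite e = x∈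
  before⊆forb {d = suc _} e x∈ rewrite e = ∈-++⁺ˡ x∈

  forb-sibling : ∀ {w x v} → Child w v → Child x v → idx x (children v) < idx w (children v) →
                 x ∈ forb w
  forb-sibling (refl , e) cx lt = before⊆forb e (∈-before (∈-children⁺ cx) lt)

  inherited⊆forb : ∀ {w v d x} → Child w v → depth v ≡ suc d → x ∈ inherited w → x ∈ forb w
  inherited⊆forb {w} {x = x} (refl , e) e′ x∈ =
    subst (λ m → x ∈ forb′ m w) (sym (trans e (cong suc e′)))
      (∈-++⁺ʳ (before w (children (parent w))) x∈)

  inherited-early : ∀ {w x} → Early w → x ∈ edgesAt (parent (parent w)) → x ∈ inherited w
  inherited-early {w} ew x∈ with early? w
  ... | yes _ = x∈
  ... | no ¬e = contradiction ew ¬e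

  inherited-parent : ∀ {w d} → depth (parent w) ≡ suc d → parent w ∈ inherited w
  inherited-parent {w} e with early? w
  ... | yes _ = v∈edgesAt-parent e
  ... | no _  = here refl

  -- Early edges respect dominance too, since they forbid every edge at the grandparent.
  inherited-after : ∀ {w d x} → depth (parent w) ≡ suc d →
                    x ∈ after (parent w) (edgesAt (parent (parent w))) → x ∈ inherited w
  inherited-after {w} e x∈ with early? w
  ... | yes _ = after-⊆ (v∈edgesAt-parent e) x∈
  ... | no _  = there x∈

  inherited⊆edgesAt : ∀ {w d x} → depth (parent w) ≡ suc d → x ∈ inherited w →
                      x ∈ edgesAt (parent (parent w))
  inherited⊆edgesAt {w} e x∈ with early? w
  inherited⊆edgesAt e x∈          | yes _ = x∈
  inherited⊆edgesAt e (here refl) | no _  = v∈edgesAt-parent e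
  inherited⊆edgesAt e (there x∈)  | no _  = after-⊆ (v∈edgesAt-parent e) x∈

  -- The order of colouring

  -- Lexicographic order by depth, then sibling position, as one number: the position is at most
  -- `n`, hence a digit in base `suc n`.
  rank : Fin n → ℕ
  rank w = depth w * suc n + siblingIdx w

  siblingIdx≤n : ∀ w → siblingIdx w ≤ n
  siblingIdx≤n w = begin
    siblingIdx w                     ≤⟨ idx-≤ w (children (parent w)) ⟩
    length (children (parent w))     ≤⟨ length-children (parent w) ⟩
    deg G (parent w)                 ≤⟨ length-filter _ (allFin n) ⟩
    length (allFin n)                ≡⟨ length-tabulate {n = n} (λ i → i) ⟩
    n                                ∎
    where open ≤-Reasoning

  before-rank : ∀ {w v u} → Child w v → u ∈ before w (children v) → rank u < rank w
  before-rank c@(refl , e) u∈ with before-⊆ (∈-children⁺ c) u∈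
  ... | u∈ch , lt with ∈-children⁻ u∈ch
  ...   | p , e′ rewrite p | e | e′ = +-monoʳ-< _ lt

  depth-rank : ∀ {u w} → depth u < depth w → rank u < rank w
  depth-rank {u} {w} lt = begin-strict
    depth u * suc n + siblingIdx u   <⟨ +-monoʳ-< (depth u * suc n) (s≤s (siblingIdx≤n u)) ⟩
    depth u * suc n + suc n          ≡⟨ +-comm _ (suc n) ⟩
    suc (depth u) * suc n            ≤⟨ *-monoˡ-≤ (suc n) lt ⟩
    depth w * suc n                  ≤⟨ m≤m+n _ _ ⟩
    rank w                           ∎
    where open ≤-Reasoning

  inherited-rank : ∀ {w d u} → depth w ≡ suc (suc d) → u ∈ inherited w → rank u < rank w
  inherited-rank {w} {d} {u} e u∈ = depth-rank (begin-strict
    depth u                              ≤⟨ edgesAt-depth (inherited⊆edgesAt (parent-depth e) u∈) ⟩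
    suc (depth (parent (parent w)))      ≡⟨ cong suc (parent-depth (parent-depth e)) ⟩
    suc d                                <⟨ n<1+n _ ⟩
    suc (suc d)                          ≡⟨ sym e ⟩
    depth w                              ∎)
    where open ≤-Reasoning

  forb-rank : ∀ w {u} → u ∈ forb w → rank u < rank w
  forb-rank w = go (depth w) refl
    where
    go : ∀ d → depth w ≡ d → ∀ {u} → u ∈ forb′ d w → rank u < rank w
    go (suc zero)    e u∈ = before-rank (Child-parent e) u∈
    go (suc (suc d)) e u∈ with ∈-++⁻ (before w (children (parent w))) u∈
    ... | inj₁ p = before-rank (Child-parent e) p
    ... | inj₂ p = inherited-rank e p

  -- Counting the forbidden edges

  suc-children : ∀ {v d} → depth v ≡ suc d → suc (length (children v)) ≡ length (edgesAt v)
  suc-children e = sym (cong (λ m → length (edgesAt′ m _)) e)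

  -- An early edge forbids all `dp` edges at the grandparent but has few earlier siblings,
  -- `j < dv / 2`. Any other edge inherits only `1 + dp / 2` edges and has `j + 1 < dv`.
  length-inherited : ∀ {w d} → depth w ≡ suc (suc d) →
                     siblingIdx w + length (inherited w) < bound G
  length-inherited {w} e = go
    where
    v = parent w
    p = parent v
    j = siblingIdx w
    dv = length (edgesAt v)
    dp = length (edgesAt p)
    open ≤-Reasoning
    v~p : Adj G v p
    v~p = parent-adj (parent-depth e)
    j< : suc j < suc (length (children v))
    j< = s≤s (idx-< (∈-children⁺ (Child-parent e)))
    early-bound : Early w → suc j ≤ dv / 2
    -- `Early` gives `suc j + dv / 2 < dv`, and `dv` is at most one more than twice `dv / 2`.
    early-bound ew = +-cancelʳ-≤ (dv / 2) _ _ (ℕ.s≤s⁻¹ (≤-trans ew (m≤1+2⌊m/2⌋ dv)))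
    go : j + length (inherited w) < bound G
    go with early? w
    ... | yes ew = begin-strict
      j + dp                       <⟨ +-monoˡ-< dp (early-bound ew) ⟩
      dv / 2 + dp                  ≡⟨ +-comm (dv / 2) dp ⟩
      dp + dv / 2                  ≤⟨ +-mono-≤ (length-edgesAt p) (/-monoˡ-≤ 2 (length-edgesAt v)) ⟩
      deg G p + deg G v / 2        ≤⟨ deg+half≤bound G (Adj-sym G v~p) ⟩
      bound G                      ∎
    ... | no _ = begin-strict
      j + suc (length (after v (edgesAt p)))  ≡⟨ cong (λ m → j + suc m) (length-after v (edgesAt p)) ⟩
      j + suc (dp / 2)             ≡⟨ +-suc j (dp / 2) ⟩
      suc j + dp / 2               <⟨ +-monoˡ-< (dp / 2) j< ⟩
      suc (length (children v)) + dp / 2  ≡⟨ cong (_+ dp / 2) (suc-children (parent-depth e)) ⟩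
      dv + dp / 2                  ≤⟨ +-mono-≤ (length-edgesAt v) (/-monoˡ-≤ 2 (length-edgesAt p)) ⟩
      deg G v + deg G p / 2        ≤⟨ deg+half≤bound G v~p ⟩
      bound G                      ∎

  length-forb : ∀ w {d} → depth w ≡ suc d → length (forb w) < bound G
  length-forb w {zero} e = begin-strict
    length (forb w)                        ≡⟨ cong (λ m → length (forb′ m w)) e ⟩
    length (before w (children (parent w))) ≡⟨ length-before w (children (parent w)) ⟩
    siblingIdx w                           <⟨ idx-< (∈-children⁺ (Child-parent e)) ⟩
    length (children (parent w))           ≤⟨ length-children (parent w) ⟩
    deg G (parent w)                       ≤⟨ m≤m+n _ _ ⟩
    deg G (parent w) + deg G w / 2         ≤⟨ deg+half≤bound G (Adj-sym G (parent-adj e)) ⟩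
    bound G                                ∎
    where open ≤-Reasoning
  length-forb w {suc d} e = begin-strict
    length (forb w)                        ≡⟨ cong (λ m → length (forb′ m w)) e ⟩
    length (before w (children (parent w)) ++ inherited w)
                                           ≡⟨ length-++ (before w (children (parent w))) ⟩
    length (before w (children (parent w))) + length (inherited w)
                                           ≡⟨ cong (_+ length (inherited w)) (length-before w (children (parent w))) ⟩
    siblingIdx w + length (inherited w)    <⟨ length-inherited e ⟩
    bound G                                ∎
    where open ≤-Reasoning

  -- Avoiding forbidden edges gives a star edge colouring

  module _ (C : Fin n → ℕ)
           (avoid : ∀ {w v u} → Child w v → u ∈ forb w → C w ≢ C u) where

    colour : EdgeColouring G
    colour u v = C (lower u v)

    colour-down : ∀ {u v} → Child u v → colour v u ≡ C u
    colour-down c = cong C (lower-child c)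

    colour-up : ∀ {u v} → Child u v → colour u v ≡ C u
    colour-up c = cong C (lower-child′ c)

    siblings-≢ : ∀ {u v w} → Child v u → Child w u → v ≢ w → C v ≢ C w
    siblings-≢ {u} {v} {w} cv cw v≢w e with <-cmp (idx v (children u)) (idx w (children u))
    ... | tri< lt _ _ = avoid cw (forb-sibling cw cv lt) (sym e)
    ... | tri≈ _ eq _ = v≢w (idx-inj (∈-children⁺ cv) (∈-children⁺ cw) eq)
    ... | tri> _ _ gt = avoid cv (forb-sibling cv cw gt) e

    parent-≢ : ∀ {u v w} → Child u v → Child w u → C w ≢ C u
    parent-≢ (_ , e) cw@(refl , _) = avoid cw (inherited⊆forb cw e (inherited-parent e))

    after-≢ : ∀ {v p w x} → Child v p → Child w v → x ∈ after v (edgesAt p) → C w ≢ C x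
    after-≢ (refl , e) cw@(refl , _) x∈ = avoid cw (inherited⊆forb cw e (inherited-after e x∈))

    proper : Proper G colour
    proper u v w a b v≢w e with orient a | orient b
    ... | inj₁ (refl , _) | inj₁ (refl , _) = v≢w refl
    ... | inj₁ c | inj₂ d = parent-≢ c d (trans (sym (colour-down d)) (trans (sym e) (colour-up c)))
    ... | inj₂ c | inj₁ d = parent-≢ d c (trans (sym (colour-down c)) (trans e (colour-up d)))
    ... | inj₂ c | inj₂ d = siblings-≢ c d v≢w (trans (sym (colour-down c)) (trans e (colour-down d)))

    child-of : ∀ {p x x′} → Child x p → Adj G x x′ → x′ ≢ p → Child x′ x
    child-of (refl , _) a x′≢p with orient a
    ... | inj₁ (refl , _) = contradiction refl x′≢p
    ... | inj₂ c          = c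

    -- If `y` is early, its edge avoids every colour at `x`, refuting the first recurrence.
    -- Otherwise it dominates the edge above `p`, so the edge below `y` avoids that colour, refuting
    -- the second.
    no-conflict-down-up : ∀ {p x y x′ y′} → Child p x → Child y p → Adj G x x′ → Adj G y y′ →
                          y′ ≢ p → colour x x′ ≡ colour p y → colour y y′ ≡ colour p x → ⊥
    no-conflict-down-up {p} {x} {y} {x′} {y′} cp@(refl , ep) cy@(refl , ey) ax ay y′≢p e f with early? y
    ... | yes ew = avoid cy (inherited⊆forb cy ep (inherited-early ew (lower∈edgesAt ax)))
                     (trans (sym (colour-down cy)) (sym e))
    ... | no ¬ew = after-≢ cy cy′ (after-wrap (self∈edgesAt ep) lo hi)
                     (trans (sym (colour-down cy′)) (trans f (colour-up cp)))
      where
      cy′ : Child y′ y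
      cy′ = child-of cy ay y′≢p
      d = length (edgesAt p)
      idx-p : idx p (edgesAt p) ≡ 0
      idx-p = trans (cong (λ m → idx p (edgesAt′ m p)) ep) (idx-head p (children p))
      idx-y : idx y (edgesAt p) ≡ suc (siblingIdx y)
      idx-y = trans (cong (λ m → idx y (edgesAt′ m p)) ep) (idx-tail (children p) (Child⇒≢ cy))
      open ≤-Reasoning
      lo : idx y (edgesAt p) < d + idx p (edgesAt p)
      lo = <-≤-trans (idx-< (children⊆edgesAt (∈-children⁺ cy))) (m≤m+n d _)
      hi : d + idx p (edgesAt p) ≤ idx y (edgesAt p) + d / 2
      -- The edge above `p` heads `edgesAt p`, so its second copy is at position `d`; failing
      -- `Early` means precisely that the successors of `y` reach it.
      hi = begin
        d + idx p (edgesAt p)      ≡⟨ trans (cong (d +_) idx-p) (+-identityʳ d) ⟩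
        d                          ≤⟨ ≮⇒≥ ¬ew ⟩
        suc (siblingIdx y) + d / 2 ≡⟨ cong (_+ d / 2) (sym idx-y) ⟩
        idx y (edgesAt p) + d / 2  ∎

    -- Here `p` is the middle of `x′ x p y y′`. If `x` and `y` are both children, whichever edge
    -- dominates the other rules out one recurrence.
    no-conflict : ∀ {p x y x′ y′} → Adj G p x → Adj G p y → Adj G x x′ → Adj G y y′ →
                  x ≢ y → x′ ≢ p → y′ ≢ p →
                  colour x x′ ≡ colour p y → colour y y′ ≡ colour p x → ⊥
    no-conflict px py xx′ yy′ x≢y x′≢p y′≢p e f with orient px | orient py
    ... | inj₁ (refl , _) | inj₁ (refl , _) = x≢y refl
    ... | inj₁ c | inj₂ d = no-conflict-down-up c d xx′ yy′ y′≢p e f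
    ... | inj₂ c | inj₁ d = no-conflict-down-up d c yy′ xx′ x′≢p f e
    ... | inj₂ c | inj₂ d
      with after-total (children⊆edgesAt (∈-children⁺ c)) (children⊆edgesAt (∈-children⁺ d)) x≢y
    ...   | inj₁ y∈ = let c′ = child-of c xx′ x′≢p in
                      after-≢ c c′ y∈ (trans (sym (colour-down c′)) (trans e (colour-down d)))
    ...   | inj₂ x∈ = let d′ = child-of d yy′ y′≢p in
                      after-≢ d d′ x∈ (trans (sym (colour-down d′)) (trans f (colour-down c)))

    colour-sym : WellDefinedC G colour
    colour-sym u v a = cong C (lower-sym a)

    two-colours : ∀ {a b x y z : ℕ} → (x ≡ a ⊎ x ≡ b) → (y ≡ a ⊎ y ≡ b) → (z ≡ a ⊎ z ≡ b) →
                  x ≢ y → y ≢ z → x ≡ z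
    two-colours (inj₁ refl) (inj₁ refl) _           x≢y _   = contradiction refl x≢y
    two-colours (inj₂ refl) (inj₂ refl) _           x≢y _   = contradiction refl x≢y
    two-colours (inj₁ refl) (inj₂ refl) (inj₁ refl) _   _   = refl
    two-colours (inj₁ refl) (inj₂ refl) (inj₂ refl) _   y≢z = contradiction refl y≢z
    two-colours (inj₂ refl) (inj₁ refl) (inj₂ refl) _   _   = refl
    two-colours (inj₂ refl) (inj₁ refl) (inj₁ refl) _   y≢z = contradiction refl y≢z

    far : ∀ {v₀ v₁ v₂ v₃ v₄ : Fin n} → v₀ ≢ v₂ → Unique (v₀ ∷ v₁ ∷ v₂ ∷ v₃ ∷ v₄ ∷ []) ⊎ v₄ ≡ v₀ → v₂ ≢ v₄
    far _     (inj₁ (_ ∷ _ ∷ (_ ∷ v₂≢v₄ ∷ []) ∷ _)) = v₂≢v₄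
    far v₀≢v₂ (inj₂ refl)                           = ≢-sym v₀≢v₂

    star : StarEdgeColouring G colour
    star = colour-sym , proper , λ where
      v₀ v₁ v₂ v₃ v₄ (a₀ , a₁ , a₂ , a₃ , (_ ∷ v₀≢v₂ ∷ _) ∷ (_ ∷ v₁≢v₃ ∷ _) ∷ (v₂≢v₃ ∷ []) ∷ _ , closing)
        (_ , _ , c₀ , c₁ , c₂ , c₃) →
        let v₂≢v₄ = far v₀≢v₂ closing
            ne : ∀ {u v w} → Adj G u v → Adj G v w → u ≢ w → colour u v ≢ colour v w
            ne a b u≢w e = proper _ _ _ (Adj-sym G a) b u≢w (trans (sym (colour-sym _ _ a)) e)
        -- The middle vertex is `v₂`. Properness forces two colours to alternate, which yields both
        -- recurrences.
        in no-conflict (Adj-sym G a₁) a₂ (Adj-sym G a₀) a₃ v₁≢v₃ v₀≢v₂ (≢-sym v₂≢v₄)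
             (trans (sym (colour-sym _ _ a₀)) (two-colours c₀ c₁ c₂ (ne a₀ a₁ v₀≢v₂) (ne a₁ a₂ v₁≢v₃)))
             (trans (sym (two-colours c₁ c₂ c₃ (ne a₁ a₂ v₁≢v₃) (ne a₂ a₃ v₂≢v₄))) (colour-sym _ _ a₁))

  -- Colouring from the lists

  choosable : StarEdgeChoosable G (bound G)
  -- The list at the root is meaningless; the guarantee of `greedy` is invoked only at children.
  choosable L L-sym adm with greedy rank forb forb-rank (λ w → L w (parent w))
  ... | C , spec = colour C avoid , from-lists , star C avoid
    where
    coloured : ∀ {w v} → Child w v → C w ∈ L w v × (∀ {u} → u ∈ forb w → C w ≢ C u)
    coloured {w} c@(refl , e) = let uq , k≤ = adm w _ (Child⇒Adj c) in
      spec w uq (<-≤-trans (length-forb w e) k≤)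
    avoid : ∀ {w v u} → Child w v → u ∈ forb w → C w ≢ C u
    avoid c = proj₂ (coloured c)
    from-lists : FromLists G L (colour C avoid)
    from-lists u v a with orient a
    ... | inj₁ c = subst (_∈ L u v) (sym (colour-up C avoid c)) (proj₁ (coloured c))
    ... | inj₂ c = subst (_∈ L u v) (sym (colour-down C avoid c))
                     (subst (C v ∈_) (L-sym v u (Adj-sym G a)) (proj₁ (coloured c)))

theorem15 : (n : ℕ) (T : Graph n) → IsTree T → HasEdge T →
    ListStarChromaticIndex≤ T ((θ T + Δ T) / 2)
-- An endpoint of the given edge serves as the root.
theorem15 n T tree (r , _) = bound T , ≤-refl , choosable T (rooting T tree r)
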